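{- Let $L=\{d\}$ be the signature whose only symbol is the distance symbol $d$, with bound $[0,1]$, and let $\Omega=\Omega_{\mathrm L}$ be the 1-Lipschitz weak modulus, $\Omega_{\mathrm L}(\delta)=\sup_i\delta_i$. Then for any two separable complete metric spaces $A,B$ of diameter at most $1$, $$r_\infty(A,B)=d_{\mathrm{GH}}(A,B),$$ where $r_\infty$ is computed with respect to $\Omega_{\mathrm L}$ and $d_{\mathrm{GH}}$ is the Gromov–Hausdorff distance.
   Context: For closed subsets $A,B$ of a metric space $(C,d)$, $d_{\mathrm H}(A,B)=\max\bigl(\sup_{x\in A}d(x,B),\sup_{y\in B}d(y,A)\bigr)$. For metric spaces $A,B$, $d_{\mathrm{GH}}(A,B)=\inf_{f_1,f_2}d_{\mathrm H}(f_1(A),f_2(B))$ over all isometric embeddings $f_1,f_2$ of $A,B$ into a third metric space $C$. Basic formulas. In the signature $\{d\}$, atomic formulas are $d(x_i,x_j)$ with variables among $x_0,x_1,\dots$; the modulus of $d(x_i,x_j)$ is $\Delta(\delta)=\delta_i+\delta_j$ and its bound is $[0,1]$. A basic formula is $\phi=f(\phi_0,\dots,\phi_{m-1})$ with $\phi_l$ atomic and $f:[0,1]^m\to\mathbb R$ continuous; its modulus is $\Delta_\phi=\Delta_f\circ(\Delta_{\phi_l})_{l<m}$, where $\Delta_f(\delta)=\sup\{|f(x)-f(y)|:x,y\in[0,1]^m,\ |x_l-y_l|\le\delta_l\}$. $\phi^A$ is its interpretation in a metric space $A$. A basic formula depending only on $x_0,\dots,x_{n-1}$ is a basic $n$-ary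 $\Omega_{\mathrm L}$-formula if $\Delta_\phi(\delta_0,\dots,\delta_{n-1})\le\max_{i<n}\delta_i$ for all $\delta\in[0,\infty)^n$. Back-and-forth pseudo-distances (with respect to $\Omega_{\mathrm L}$), with values in $[0,\infty]$, for $\bar a\in A^n,\bar b\in B^n$: $r_0(A\bar a,B\bar b)=\sup_\phi|\phi^A(\bar a)-\phi^B(\bar b)|$ over all basic $n$-ary $\Omega_{\mathrm L}$-formulas $\phi$; $r_\alpha=\sup_{\beta<\alpha}r_\beta$ for $\alpha$ limit or $\alpha=\infty$ (greater than all ordinals); $r_{\alpha+1}(A\bar a,B\bar b)=\sup_{c\in A,d\in B}\inf_{c'\in A,d'\in B}\max\bigl(r_\alpha(A\bar ac,B\bar bd'),r_\alpha(A\bar ac',B\bar bd)\bigr)$. For $n=0$ write $r_\alpha(A,B)$. -}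

module Defs where

open import Algebra.Bundles using (CommutativeRing)
import Algebra.Construct.NaturalChoice.Max as Max
open import Axiom.ExcludedMiddle using (ExcludedMiddle)
open import Data.Fin.Base using (Fin)
open import Data.Nat.Base as ℕ using (ℕ; zero; suc)
open import Data.Product.Base using (Σ; ∃; _×_; _,_; proj₁; proj₂)
open import Data.Sum.Base using (_⊎_; inj₁; inj₂; [_,_]′)
open import Data.Vec.Base using (Vec; _∷ʳ_; lookup)
open import Function.Metric.Structures using (IsGeneralMetric)
open import Level using (0ℓ)
open import Relation.Binary.Bundles using (TotalOrder)
open import Relation.Binary.Core using (Rel)
import Relation.Binary.Construct.Add.Supremum.Equality as Eq⁺
import Relation.Binary.Construct.Add.Supremum.NonStrict as NonStrict⁺
import Relation.Binary.Construct.NonStrictToStrict as ToStrict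
open import Relation.Binary.PropositionalEquality.Core using (_≡_; refl)
open import Relation.Binary.Structures using (IsTotalOrder)
open import Relation.Nullary.Construct.Add.Supremum using (_⁺; ⊤⁺; [_])
open import Relation.Nullary.Decidable using (Dec; yes; no; True; toWitness; fromWitness)
open import Relation.Nullary.Negation using (¬_; contradiction)
open import Relation.Unary using (Pred)

-- Complete ordered fields are unique up to isomorphism, so quantifying over
-- them is how ℝ is spoken of here.  Equality is a setoid equality because
-- there are no quotient types.
record CompleteOrderedField : Set₁ where
  infix 4 _≤_
  field
    commutativeRing : CommutativeRing 0ℓ 0ℓ
  open CommutativeRing commutativeRing public
    renaming (Carrier to ℝ; sym to ≈-sym; trans to ≈-trans; refl to ≈-refl)
    hiding (isEquivalence)
  field
    _≤_          : Rel ℝ 0ℓ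
    isTotalOrder : IsTotalOrder _≈_ _≤_
    +-monoˡ-≤    : ∀ {x y} z → x ≤ y → x + z ≤ y + z
    *-nonNeg     : ∀ {x y} → 0# ≤ x → 0# ≤ y → 0# ≤ x * y
    0≉1          : ¬ 0# ≈ 1#
    inverse      : ∀ x → ¬ x ≈ 0# → ∃ λ y → x * y ≈ 1#

  IsLUB : Pred ℝ 0ℓ → ℝ → Set
  IsLUB S s = (∀ x → S x → x ≤ s) × (∀ b → (∀ x → S x → x ≤ b) → s ≤ b)

  field
    complete : ∀ (S : Pred ℝ 0ℓ) → ∃ S → (∃ λ b → ∀ x → S x → x ≤ b) → ∃ (IsLUB S)

  totalOrder : TotalOrder 0ℓ 0ℓ 0ℓ
  totalOrder = record { isTotalOrder = isTotalOrder }

  open IsTotalOrder isTotalOrder public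
    using (isPartialOrder; total; antisym)
    renaming (reflexive to ≤-reflexive; trans to ≤-trans)
  open ToStrict _≈_ _≤_ public using (_<_)
  open Max totalOrder public using (_⊔_; x≤x⊔y; x≤y⊔x)

  infix 8 ∣_∣
  ∣_∣ : ℝ → ℝ
  ∣ x ∣ = x ⊔ (- x)

  0≤∣x∣ : ∀ x → 0# ≤ ∣ x ∣
  0≤∣x∣ x with total 0# x
  ... | inj₁ 0≤x = ≤-trans 0≤x (x≤x⊔y x (- x))
  ... | inj₂ x≤0 = ≤-trans 0≤-x (x≤y⊔x x (- x))
    where
    0≤-x : 0# ≤ - x
    0≤-x = ≤-trans (≤-reflexive (≈-sym (-‿inverseʳ x)))
             (≤-trans (+-monoˡ-≤ (- x) x≤0) (≤-reflexive (+-identityˡ (- x))))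

  +-nonNeg : ∀ {x y} → 0# ≤ x → 0# ≤ y → 0# ≤ x + y
  +-nonNeg {x} {y} 0≤x 0≤y = ≤-trans 0≤y
    (≤-trans (≤-reflexive (≈-sym (+-identityˡ y))) (+-monoˡ-≤ y 0≤x))

-- Ordinals as trees.  The strictness condition on lim makes every tree denote
-- a genuine ordinal of the corresponding kind, since lim f is then the
-- supremum of a nonempty set of ordinals without a largest element.  In the
-- other direction, a limit ordinal is the limit of the family of all its
-- elements.  One ordinal may have many trees, which is harmless for suprema.
infix 4 _<ᵒ_
data Ord : Set₁
data _<ᵒ_ : Ord → Ord → Set₁

data Ord where
  zeroᵒ : Ord
  sucᵒ  : Ord → Ord
  limᵒ  : (I : Set) (f : I → Ord) → I → (∀ i → ∃ λ j → f i <ᵒ f j) → Ord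

data _<ᵒ_ where
  <-suc  : ∀ {α} → α <ᵒ sucᵒ α
  <-step : ∀ {α β} → α <ᵒ β → α <ᵒ sucᵒ β
  <-lim  : ∀ {α I f i₀ incr} (i : I) → α <ᵒ f i → α <ᵒ limᵒ I f i₀ incr

module Theory (em : ∀ {ℓ} → ExcludedMiddle ℓ) (R : CompleteOrderedField) where
  open CompleteOrderedField R

  ℝ≥0 : Set
  ℝ≥0 = ∃ λ x → 0# ≤ x

  0≥0 : ℝ≥0
  0≥0 = 0# , ≤-reflexive ≈-refl

  _≤≥0_ _≈≥0_ : Rel ℝ≥0 0ℓ
  x ≤≥0 y = proj₁ x ≤ proj₁ y
  x ≈≥0 y = proj₁ x ≈ proj₁ y

  _+≥0_ : ℝ≥0 → ℝ≥0 → ℝ≥0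
  (x , 0≤x) +≥0 (y , 0≤y) = x + y , +-nonNeg 0≤x 0≤y

  [0,∞] : Set
  [0,∞] = ℝ≥0 ⁺

  open NonStrict⁺ _≤≥0_ public using (_≤⊤⁺; [_]) renaming (_≤⁺_ to _≤∞_)
  open Eq⁺ _≈≥0_ public using () renaming (_≈⁺_ to _≈∞_)

  gap : ℝ → ℝ → [0,∞]
  gap x y = [ ∣ x - y ∣ , 0≤∣x∣ (x - y) ]

  module _ {ℓ} {I : Set ℓ} (f : I → [0,∞]) where

    Bounded : Set ℓ
    Bounded = ∃ λ (b : ℝ≥0) → ∀ i → f i ≤∞ [ b ]

    -- 0 is included so that the supremum of the empty family is 0; True
    -- replaces a proposition in Set ℓ by an equivalent one in Set.
    Value : Pred ℝ 0ℓ
    Value x = True (em {P = x ≈ 0# ⊎ ∃ λ i → ∃ λ y → f i ≡ [ y ] × x ≈ proj₁ y})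

    private
      lub : Bounded → ∃ (IsLUB Value)
      lub ((b , 0≤b) , f≤b) = complete Value (0# , fromWitness (inj₁ ≈-refl))
        (b , λ x v → [ (λ x≈0 → ≤-trans (≤-reflexive x≈0) 0≤b)
                     , (λ (i , y , fi≡y , x≈y) → ≤-trans (≤-reflexive x≈y) (below i fi≡y))
                     ]′ (toWitness v))
        where
        below : ∀ i {y} → f i ≡ [ y ] → proj₁ y ≤ b
        below i fi≡y with f i | f≤b i
        below i refl | _ | [ y≤b ] = y≤b

      sup : Dec Bounded → [0,∞]
      sup (yes bd) = let s , s-upper , _ = lub bd
                     in [ s , s-upper 0# (fromWitness (inj₁ ≈-refl)) ]
      sup (no  _)  = ⊤⁺

      sup-upper : ∀ bd? i → f i ≤∞ sup bd?
      sup-upper (no _)   i = f i ≤⊤⁺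
      sup-upper (yes bd) i with f i in eq | proj₂ bd i
      ... | [ y ] | _ = [ proj₁ (proj₂ (lub bd)) (proj₁ y)
                            (fromWitness (inj₂ (i , y , eq , ≈-refl))) ]

      sup-least : ∀ bd? b → (∀ i → f i ≤∞ b) → sup bd? ≤∞ b
      sup-least bd?      ⊤⁺    f≤b = _ ≤⊤⁺
      sup-least (no ¬bd) [ b ] f≤b = contradiction (b , f≤b) ¬bd
      sup-least (yes bd) [ b ] f≤b = [ proj₂ (proj₂ (lub bd)) (proj₁ b) below ]
        where
        below : ∀ x → Value x → x ≤ proj₁ b
        below x v with toWitness v
        ... | inj₁ x≈0 = ≤-trans (≤-reflexive x≈0) (proj₂ b)
        ... | inj₂ (i , y , eq , x≈y) with f i | f≤b i
        below x v | inj₂ (i , y , refl , x≈y) | _ | [ y≤b ] =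
          ≤-trans (≤-reflexive x≈y) y≤b

    ⨆ : [0,∞]
    ⨆ = sup em

    ⨆-upper : ∀ i → f i ≤∞ ⨆
    ⨆-upper = sup-upper em

    ⨆-least : ∀ b → (∀ i → f i ≤∞ b) → ⨆ ≤∞ b
    ⨆-least = sup-least em

  module _ {ℓ} {I : Set ℓ} (f : I → [0,∞]) where

    LowerBound : Set ℓ
    LowerBound = ∃ λ (b : [0,∞]) → ∀ i → b ≤∞ f i

    ⨅ : [0,∞]
    ⨅ = ⨆ {I = LowerBound} proj₁

    ⨅-lower : ∀ i → ⨅ ≤∞ f i
    ⨅-lower i = ⨆-least proj₁ (f i) (λ (_ , b≤f) → b≤f i)

    ⨅-greatest : ∀ b → (∀ i → b ≤∞ f i) → b ≤∞ ⨅
    ⨅-greatest b b≤f = ⨆-upper proj₁ (b , b≤f)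

  infixl 6 _⊔∞_
  _⊔∞_ : [0,∞] → [0,∞] → [0,∞]
  [ x , 0≤x ] ⊔∞ [ y , _ ] = [ x ⊔ y , ≤-trans 0≤x (x≤x⊔y x y) ]
  [ _ ]       ⊔∞ ⊤⁺        = ⊤⁺
  ⊤⁺          ⊔∞ _         = ⊤⁺

  record MetricSpace : Set₁ where
    field
      Carrier  : Set
      _≈ₛ_     : Rel Carrier 0ℓ
      d        : Carrier → Carrier → ℝ
      isMetric : IsGeneralMetric _≈ₛ_ _≈_ _≤_ 0# _+_ d
    open IsGeneralMetric isMetric public using (nonNegative)

    d∞ : Carrier → Carrier → [0,∞]
    d∞ x y = [ d x y , nonNegative ]

  open MetricSpace using (Carrier)

  IsCauchy : (A : MetricSpace) → (ℕ → Carrier A) → Set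
  IsCauchy A s = ∀ ε → 0# < ε → ∃ λ N → ∀ m n → N ℕ.≤ m → N ℕ.≤ n → d (s m) (s n) < ε
    where open MetricSpace A

  ConvergesTo : (A : MetricSpace) → (ℕ → Carrier A) → Carrier A → Set
  ConvergesTo A s x = ∀ ε → 0# < ε → ∃ λ N → ∀ n → N ℕ.≤ n → d (s n) x < ε
    where open MetricSpace A

  Complete : MetricSpace → Set
  Complete A = ∀ s → IsCauchy A s → ∃ λ x → ConvergesTo A s x

  -- The dense sequence makes the space nonempty, as structures in continuous
  -- logic are by convention.
  Separable : MetricSpace → Set
  Separable A = ∃ λ (s : ℕ → Carrier A) → ∀ x ε → 0# < ε → ∃ λ n → d x (s n) < ε
    where open MetricSpace A

  DiameterAtMost1 : MetricSpace → Set
  DiameterAtMost1 A = ∀ x y → d x y ≤ 1#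
    where open MetricSpace A

  module _ (C : MetricSpace) where
    open MetricSpace C using (d∞)

    distToSet : Carrier C → Pred (Carrier C) 0ℓ → [0,∞]
    distToSet x S = ⨅ {I = ∃ S} λ (y , _) → d∞ x y

    -- The formula is stated for arbitrary subsets; the images of complete
    -- spaces under isometric embeddings are closed.
    dH : Pred (Carrier C) 0ℓ → Pred (Carrier C) 0ℓ → [0,∞]
    dH S T = (⨆ {I = ∃ S} λ (x , _) → distToSet x T)
          ⊔∞ (⨆ {I = ∃ T} λ (y , _) → distToSet y S)

  record IsometricEmbedding (A C : MetricSpace) : Set where
    private
      module A = MetricSpace A
      module C = MetricSpace C
    field
      to       : A.Carrier → C.Carrier
      isometry : ∀ x y → C.d (to x) (to y) ≈ A.d x y

    image : Pred C.Carrier 0ℓ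
    image z = ∃ λ x → to x C.≈ₛ z

  open IsometricEmbedding using (image)

  dGH : MetricSpace → MetricSpace → [0,∞]
  dGH A B = ⨅ {I = Σ MetricSpace λ C → IsometricEmbedding A C × IsometricEmbedding B C}
              λ (C , f₁ , f₂) → dH C (image f₁) (image f₂)

  UnitInterval : Set
  UnitInterval = ∃ λ x → 0# ≤ x × x ≤ 1#

  Cube : ℕ → Set
  Cube m = Fin m → UnitInterval

  Continuous : ∀ {m} → (Cube m → ℝ) → Set
  Continuous f = ∀ x ε → 0# < ε → ∃ λ δ → 0# < δ ×
    (∀ y → (∀ l → ∣ proj₁ (x l) - proj₁ (y l) ∣ < δ) → ∣ f x - f y ∣ < ε)

  modulus : ∀ {m} → (Cube m → ℝ) → (Fin m → ℝ≥0) → [0,∞]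
  modulus {m} f δ =
    ⨆ {I = Σ (Cube m × Cube m) λ (x , y) →
             ∀ l → ∣ proj₁ (x l) - proj₁ (y l) ∣ ≤ proj₁ (δ l)}
      λ ((x , y) , _) → gap (f x) (f y)

  -- (i , j) stands for d(xᵢ,xⱼ).
  Atomic : ℕ → Set
  Atomic n = Fin n × Fin n

  atomicModulus : ∀ {n} → Atomic n → (Fin n → ℝ≥0) → ℝ≥0
  atomicModulus (i , j) δ = δ i +≥0 δ j

  record BasicFormula (n : ℕ) : Set where
    field
      {m}        : ℕ
      atoms      : Fin m → Atomic n
      connective : Cube m → ℝ
      continuous : Continuous connective

  formulaModulus : ∀ {n} → BasicFormula n → (Fin n → ℝ≥0) → [0,∞]
  formulaModulus φ δ = modulus connective λ l → atomicModulus (atoms l) δ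
    where open BasicFormula φ

  ΩL : ∀ {n} → (Fin n → ℝ≥0) → [0,∞]
  ΩL δ = ⨆ λ i → [ δ i ]

  ΩLFormula : ℕ → Set
  ΩLFormula n = Σ (BasicFormula n) λ φ → ∀ δ → formulaModulus φ δ ≤∞ ΩL δ

  module _ (A : MetricSpace) (diamA : DiameterAtMost1 A) where
    open MetricSpace A using (d; nonNegative)

    ⟦_⟧ₐ : ∀ {n} → Atomic n → Vec (Carrier A) n → UnitInterval
    ⟦ i , j ⟧ₐ a = d (lookup a i) (lookup a j) , nonNegative , diamA _ _

    ⟦_⟧ : ∀ {n} → BasicFormula n → Vec (Carrier A) n → ℝ
    ⟦ φ ⟧ a = connective λ l → ⟦ atoms l ⟧ₐ a
      where open BasicFormula φ

  module BackAndForth (A B : MetricSpace)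
                      (diamA : DiameterAtMost1 A) (diamB : DiameterAtMost1 B) where

    r₀ : ∀ {n} → Vec (Carrier A) n → Vec (Carrier B) n → [0,∞]
    r₀ {n} a b = ⨆ {I = ΩLFormula n} λ (φ , _) → gap (⟦_⟧ A diamA φ a) (⟦_⟧ B diamB φ b)

    mutual
      r : Ord → ∀ {n} → Vec (Carrier A) n → Vec (Carrier B) n → [0,∞]
      r zeroᵒ                a b = r₀ a b
      r α@(limᵒ I f i₀ incr) a b = ⨆ {I = ∃ (_<ᵒ α)} λ (_ , β<α) → r< α β<α a b
      r (sucᵒ α)             a b =
        ⨆ {I = Carrier A × Carrier B} λ (c , d) →
        ⨅ {I = Carrier A × Carrier B} λ (c′ , d′) →
          r α (a ∷ʳ c) (b ∷ʳ d′) ⊔∞ r α (a ∷ʳ c′) (b ∷ʳ d)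

      -- For β<α : β <ᵒ α this is r β; the detour makes the recursion structural.
      r< : ∀ α {β} → β <ᵒ α → ∀ {n} → Vec (Carrier A) n → Vec (Carrier B) n → [0,∞]
      r< (sucᵒ α)       <-suc         = r α
      r< (sucᵒ α)       (<-step β<α)  = r< α β<α
      r< (limᵒ I f _ _) (<-lim i β<α) = r< (f i) β<α

    r<-correct : ∀ α {β} (β<α : β <ᵒ α) {n} (a : Vec (Carrier A) n) b →
                 r< α β<α a b ≡ r β a b
    r<-correct (sucᵒ α)       <-suc         a b = refl
    r<-correct (sucᵒ α)       (<-step β<α)  a b = r<-correct α β<α a b
    r<-correct (limᵒ I f _ _) (<-lim i β<α) a b = r<-correct (f i) β<α a b

    r∞ : ∀ {n} → Vec (Carrier A) n → Vec (Carrier B) n → [0,∞]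
    r∞ a b = ⨆ λ (α : Ord) → r α a b

{-# OPTIONS --safe #-}

-- If the images of A and B in a common space have Hausdorff distance below t,
-- tuples that are pointwise t-close can be extended to t-close tuples, and
-- r_α ≤ t on them by induction on α.  Conversely, being below t is preserved by
-- the back-and-forth moves for r_∞, so playing dense sequences of A and B yields
-- dense families p in A and q in B, whose distances differ by at most 2t because
-- ½ d(xᵢ,xⱼ) is an Ω_L-formula.  The metric d(x,y) = infᵢ (t + d(x,pᵢ) + d(y,qᵢ))
-- on A ⊎ B then gives d_GH ≤ t.

module Submission where

import Algebra.Properties.Group as GroupProperties
import Algebra.Properties.Ring as RingProperties
import Algebra.Solver.Ring.NaturalCoefficients.Default as SemiringSolver
import Algebra.Construct.NaturalChoice.Max as Max
open import Axiom.DoubleNegationElimination using (em⇒dne)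
open import Axiom.ExcludedMiddle using (ExcludedMiddle)
open import Data.Fin.Base using (Fin; zero; suc; inject₁; fromℕ)
open import Data.Nat.Base as ℕ using (ℕ; zero; suc)
import Data.Nat.Properties as ℕ
open import Data.Product.Base using (∃; _×_; _,_; proj₁; proj₂)
open import Data.Sum.Base using (_⊎_; inj₁; inj₂)
open import Data.Sum.Relation.Binary.Pointwise as Sum using (inj₁; inj₂)
open import Data.Vec.Base using (Vec; []; _∷_; _∷ʳ_; lookup)
open import Data.Vec.Relation.Binary.Pointwise.Inductive as Pointwise using (Pointwise; []; _∷_)
open import Function.Metric.Structures using (IsGeneralMetric)
open import Level using (0ℓ)
open import Relation.Binary.Bundles using (Poset)
import Relation.Binary.Construct.Add.Supremum.NonStrict as NonStrict⁺
import Relation.Binary.Construct.NonStrictToStrict as ToStrict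
open import Relation.Binary.Core using (Rel; REL)
open import Relation.Binary.PropositionalEquality.Core as ≡ using (_≡_)
import Relation.Binary.Reasoning.PartialOrder as PosetReasoning
open import Relation.Nullary.Construct.Add.Supremum using (⊤⁺; [_])
open import Relation.Nullary.Negation using (¬_; contradiction)
open import Defs

-- Vectors extended at the end.

module _ {a} {X : Set a} where

  lookup-∷ʳ-inject₁ : ∀ {n} (xs : Vec X n) x i → lookup (xs ∷ʳ x) (inject₁ i) ≡ lookup xs i
  lookup-∷ʳ-inject₁ (y ∷ xs) x zero    = ≡.refl
  lookup-∷ʳ-inject₁ (y ∷ xs) x (suc i) = lookup-∷ʳ-inject₁ xs x i

  lookup-∷ʳ-last : ∀ {n} (xs : Vec X n) x → lookup (xs ∷ʳ x) (fromℕ n) ≡ x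
  lookup-∷ʳ-last []       x = ≡.refl
  lookup-∷ʳ-last (y ∷ xs) x = lookup-∷ʳ-last xs x

∷ʳ⁺ : ∀ {a b ℓ} {X : Set a} {Y : Set b} {_∼_ : REL X Y ℓ} {m n x y} {xs : Vec X m} {ys : Vec Y n} →
      Pointwise _∼_ xs ys → x ∼ y → Pointwise _∼_ (xs ∷ʳ x) (ys ∷ʳ y)
∷ʳ⁺ []             x∼y = x∼y ∷ []
∷ʳ⁺ (z∼w ∷ xs∼ys) x∼y = z∼w ∷ ∷ʳ⁺ xs∼ys x∼y

-- Suprema of small families of ordinals.

iterate-sucᵒ : Ord → ℕ → Ord
iterate-sucᵒ α zero    = α
iterate-sucᵒ α (suc n) = sucᵒ (iterate-sucᵒ α n)

-- Adding all finite ordinals makes the family have no largest element.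
supᵒ : {I : Set} → I → (I → Ord) → Ord
supᵒ i₀ f = limᵒ _ (λ (i , n) → iterate-sucᵒ (f i) n) (i₀ , 0) λ (i , n) → (i , suc n) , <-suc

<ᵒ-supᵒ : {I : Set} (i₀ : I) {f : I → Ord} (i : I) → f i <ᵒ supᵒ i₀ f
<ᵒ-supᵒ i₀ i = <-lim (i , 1) <-suc

-- Arithmetic and infima in a complete ordered field.

module Reals (em : ∀ {ℓ} → ExcludedMiddle ℓ) (R : CompleteOrderedField) where
  open CompleteOrderedField R
  open Max totalOrder public using (⊔-lub)
  open GroupProperties +-group using (//-rightDividesʳ; //-rightDividesˡ; ⁻¹-anti-homo-//)
  open RingProperties ring using (-1*x≈-x; -‿involutive)
  open SemiringSolver commutativeSemiring using (solve; _:+_; _:=_)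

  poset : Poset 0ℓ 0ℓ 0ℓ
  poset = record { isPartialOrder = isPartialOrder }

  open PosetReasoning poset public

  ≤-refl : ∀ {x} → x ≤ x
  ≤-refl = ≤-reflexive ≈-refl

  ≰⇒> : ∀ {x y} → ¬ x ≤ y → y < x
  ≰⇒> = ToStrict.≰⇒> _≈_ _≤_ ≈-sym ≤-reflexive total

  <⇒≱ : ∀ {x y} → x < y → ¬ y ≤ x
  <⇒≱ = ToStrict.<⇒≱ _≈_ _≤_ antisym

  +-monoʳ-≤ : ∀ {x y} z → x ≤ y → z + x ≤ z + y
  +-monoʳ-≤ {x} {y} z x≤y = begin
    z + x ≈⟨ +-comm z x ⟩
    x + z ≤⟨ +-monoˡ-≤ z x≤y ⟩
    y + z ≈⟨ +-comm y z ⟩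
    z + y ∎

  +-mono-≤ : ∀ {x y z w} → x ≤ y → z ≤ w → x + z ≤ y + w
  +-mono-≤ x≤y z≤w = ≤-trans (+-monoˡ-≤ _ x≤y) (+-monoʳ-≤ _ z≤w)

  +-cancelʳ-≤ : ∀ z {x y} → x + z ≤ y + z → x ≤ y
  +-cancelʳ-≤ z {x} {y} x+z≤y+z = begin
    x           ≈⟨ //-rightDividesʳ z x ⟨
    (x + z) - z ≤⟨ +-monoˡ-≤ (- z) x+z≤y+z ⟩
    (y + z) - z ≈⟨ //-rightDividesʳ z y ⟩
    y           ∎

  +-cancelˡ-≤ : ∀ z {x y} → z + x ≤ z + y → x ≤ y
  +-cancelˡ-≤ z {x} {y} z+x≤z+y = +-cancelʳ-≤ z (begin
    x + z ≈⟨ +-comm x z ⟩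
    z + x ≤⟨ z+x≤z+y ⟩
    z + y ≈⟨ +-comm z y ⟩
    y + z ∎)

  x≤x+y : ∀ x {y} → 0# ≤ y → x ≤ x + y
  x≤x+y x {y} 0≤y = begin
    x      ≈⟨ +-identityʳ x ⟨
    x + 0# ≤⟨ +-monoʳ-≤ x 0≤y ⟩
    x + y  ∎

  -- Only the case `y ≤ x` needs work: then `x + x ≤ y + y ≤ x + y`, and one `x` cancels.
  double-cancel-≤ : ∀ {x y} → x + x ≤ y + y → x ≤ y
  double-cancel-≤ {x} {y} 2x≤2y with total x y
  ... | inj₁ x≤y = x≤y
  ... | inj₂ y≤x = +-cancelˡ-≤ x (≤-trans 2x≤2y (+-monoˡ-≤ y y≤x))

  -- If `1# ≤ 0#`, then `- 1#` is nonnegative, and so is its square, which is `1#`.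
  0≤1 : 0# ≤ 1#
  0≤1 with total 0# 1#
  ... | inj₁ 0≤1 = 0≤1
  ... | inj₂ 1≤0 = begin
    0#          ≤⟨ *-nonNeg 0≤-1 0≤-1 ⟩
    - 1# * - 1# ≈⟨ -1*x≈-x (- 1#) ⟩
    - - 1#      ≈⟨ -‿involutive 1# ⟩
    1#          ∎
    where
    0≤-1 : 0# ≤ - 1#
    0≤-1 = +-cancelʳ-≤ 1# (begin
      0# + 1#   ≈⟨ +-identityˡ 1# ⟩
      1#        ≤⟨ 1≤0 ⟩
      0#        ≈⟨ -‿inverseˡ 1# ⟨
      - 1# + 1# ∎)

  x<x+1 : ∀ x → x < x + 1#
  x<x+1 x = ≰⇒> λ x+1≤x → 0≉1 (antisym 0≤1
    (+-cancelˡ-≤ x (≤-trans x+1≤x (≤-reflexive (≈-sym (+-identityʳ x))))))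

  1+1≉0 : ¬ 1# + 1# ≈ 0#
  1+1≉0 2≈0 = 0≉1 (antisym 0≤1 (≤-trans (x≤x+y 1# 0≤1) (≤-reflexive 2≈0)))

  ½ : ℝ
  ½ = proj₁ (inverse (1# + 1#) 1+1≉0)

  ½*-double : ∀ x → ½ * x + ½ * x ≈ x
  ½*-double x = begin-equality
    ½ * x + ½ * x         ≈⟨ distribʳ x ½ ½ ⟨
    (½ + ½) * x           ≈⟨ *-congʳ (+-cong (*-identityˡ ½) (*-identityˡ ½)) ⟨
    (1# * ½ + 1# * ½) * x ≈⟨ *-congʳ (distribʳ ½ 1# 1#) ⟨
    ((1# + 1#) * ½) * x   ≈⟨ *-congʳ (proj₂ (inverse (1# + 1#) 1+1≉0)) ⟩
    1# * x                ≈⟨ *-identityˡ x ⟩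
    x                     ∎

  <-dense : ∀ {x y} → x < y → ∃ λ z → x < z × z < y
  <-dense {x} {y} x<y = z , ≰⇒> z≰x , ≰⇒> y≰z
    where
    z : ℝ
    z = ½ * (x + y)
    z≰x : ¬ z ≤ x
    z≰x z≤x = <⇒≱ x<y (+-cancelˡ-≤ x (begin
      x + y ≈⟨ ½*-double (x + y) ⟨
      z + z ≤⟨ +-mono-≤ z≤x z≤x ⟩
      x + x ∎))
    y≰z : ¬ y ≤ z
    y≰z y≤z = <⇒≱ x<y (+-cancelʳ-≤ y (begin
      y + y ≤⟨ +-mono-≤ y≤z y≤z ⟩
      z + z ≈⟨ ½*-double (x + y) ⟩
      x + y ∎))

  -- Otherwise `y < x`, and a point strictly between them violates the hypothesis. This replaces the
  -- usual passage to the limit with a small ε.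
  ≤-fromAbove : ∀ {x y} → (∀ z → y < z → x ≤ z) → x ≤ y
  ≤-fromAbove x≤ = em⇒dne em λ x≰y →
    let z , y<z , z<x = <-dense (≰⇒> x≰y) in <⇒≱ z<x (x≤ z y<z)

  <⇒0<- : ∀ {x y} → x < y → 0# < y - x
  <⇒0<- {x} {y} x<y = ≰⇒> λ y-x≤0 → <⇒≱ x<y (begin
    y           ≈⟨ //-rightDividesˡ x y ⟨
    (y - x) + x ≤⟨ +-monoˡ-≤ x y-x≤0 ⟩
    0# + x      ≈⟨ +-identityˡ x ⟩
    x           ∎)

  ∣-∣≤⇒≤+ : ∀ {x y z} → ∣ x - y ∣ ≤ z → x ≤ y + z
  ∣-∣≤⇒≤+ {x} {y} {z} ∣x-y∣≤z = begin
    x           ≈⟨ //-rightDividesˡ y x ⟨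
    (x - y) + y ≤⟨ +-monoˡ-≤ y (≤-trans (x≤x⊔y _ _) ∣x-y∣≤z) ⟩
    z + y       ≈⟨ +-comm z y ⟩
    y + z       ∎

  ∣-∣≤⇒≥+ : ∀ {x y z} → ∣ x - y ∣ ≤ z → y ≤ x + z
  ∣-∣≤⇒≥+ {x} {y} {z} ∣x-y∣≤z = begin
    y             ≈⟨ //-rightDividesˡ x y ⟨
    (y - x) + x   ≈⟨ +-congʳ (⁻¹-anti-homo-// x y) ⟨
    - (x - y) + x ≤⟨ +-monoˡ-≤ x (≤-trans (x≤y⊔x _ _) ∣x-y∣≤z) ⟩
    z + x         ≈⟨ +-comm z x ⟩
    x + z         ∎

  ≤+⇒-≤ : ∀ {x y z} → x ≤ y + z → x - y ≤ z
  ≤+⇒-≤ {x} {y} {z} x≤y+z = +-cancelʳ-≤ y (begin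
    (x - y) + y ≈⟨ //-rightDividesˡ y x ⟩
    x           ≤⟨ x≤y+z ⟩
    y + z       ≈⟨ +-comm y z ⟩
    z + y       ∎)

  -≤⇒≤+ : ∀ {x y z} → x - y ≤ z → x ≤ y + z
  -≤⇒≤+ {x} {y} {z} x-y≤z = begin
    x           ≈⟨ //-rightDividesˡ y x ⟨
    (x - y) + y ≤⟨ +-monoˡ-≤ y x-y≤z ⟩
    z + y       ≈⟨ +-comm z y ⟩
    y + z       ∎

  ≤-⇒+≤ : ∀ {x y z} → x ≤ z - y → y + x ≤ z
  ≤-⇒+≤ {x} {y} {z} x≤z-y = begin
    y + x       ≈⟨ +-comm y x ⟩
    x + y       ≤⟨ +-monoˡ-≤ y x≤z-y ⟩
    (z - y) + y ≈⟨ //-rightDividesˡ y z ⟩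
    z           ∎

  ∣-∣≤ : ∀ {x y z} → x ≤ y + z → y ≤ x + z → ∣ x - y ∣ ≤ z
  ∣-∣≤ {x} {y} x≤y+z y≤x+z = ⊔-lub (≤+⇒-≤ x≤y+z)
    (≤-trans (≤-reflexive (⁻¹-anti-homo-// x y)) (≤+⇒-≤ y≤x+z))

  ½*-≤ : ∀ {x y z} → x ≤ y + (z + z) → ½ * x ≤ ½ * y + z
  ½*-≤ {x} {y} {z} x≤y+2z = double-cancel-≤ (begin
    ½ * x + ½ * x             ≈⟨ ½*-double x ⟩
    x                         ≤⟨ x≤y+2z ⟩
    y + (z + z)               ≈⟨ +-congʳ (½*-double y) ⟨
    (½ * y + ½ * y) + (z + z) ≈⟨ solve 2 (λ u v → (u :+ u) :+ (v :+ v) := (u :+ v) :+ (u :+ v)) ≈-refl (½ * y) z ⟩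
    (½ * y + z) + (½ * y + z) ∎)

  ½*-≤⁻¹ : ∀ {x y z} → ½ * x ≤ ½ * y + z → x ≤ y + (z + z)
  ½*-≤⁻¹ {x} {y} {z} ½x≤½y+z = begin
    x                         ≈⟨ ½*-double x ⟨
    ½ * x + ½ * x             ≤⟨ +-mono-≤ ½x≤½y+z ½x≤½y+z ⟩
    (½ * y + z) + (½ * y + z) ≈⟨ solve 2 (λ u v → (u :+ v) :+ (u :+ v) := (u :+ u) :+ (v :+ v)) ≈-refl (½ * y) z ⟩
    (½ * y + ½ * y) + (z + z) ≈⟨ +-congʳ (½*-double y) ⟩
    y + (z + z)               ∎

  ∣½*-½*∣≤ : ∀ {x y z} → ∣ x - y ∣ ≤ z + z → ∣ ½ * x - ½ * y ∣ ≤ z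
  ∣½*-½*∣≤ p = ∣-∣≤ (½*-≤ (∣-∣≤⇒≤+ p)) (½*-≤ (∣-∣≤⇒≥+ p))

  ∣½*-½*∣≤⁻¹ : ∀ {x y z} → ∣ ½ * x - ½ * y ∣ ≤ z → ∣ x - y ∣ ≤ z + z
  ∣½*-½*∣≤⁻¹ p = ∣-∣≤ (½*-≤⁻¹ (∣-∣≤⇒≤+ p)) (½*-≤⁻¹ (∣-∣≤⇒≥+ p))

  -- The infimum is the least upper bound of the set of lower bounds. That set contains `0#` by
  -- `0≤f` and is bounded above by `f i₀`.
  module Inf {I : Set} (f : I → ℝ) (0≤f : ∀ i → 0# ≤ f i) (i₀ : I) where
    private
      lub : ∃ (IsLUB λ x → ∀ i → x ≤ f i)
      lub = complete _ (0# , 0≤f) (f i₀ , λ x x≤f → x≤f i₀)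

    inf : ℝ
    inf = proj₁ lub

    inf-lower : ∀ i → inf ≤ f i
    inf-lower i = proj₂ (proj₂ lub) (f i) (λ x x≤f → x≤f i)

    inf-greatest : ∀ {x} → (∀ i → x ≤ f i) → x ≤ inf
    inf-greatest = proj₁ (proj₂ lub) _

    -- Subtracting `y` turns the hypothesis into a lower bound for `f`. Inequalities with an infimum
    -- on the right can thus be checked one index at a time.
    ≤+inf : ∀ {x y} → (∀ i → x ≤ y + f i) → x ≤ y + inf
    ≤+inf x≤y+f = -≤⇒≤+ (inf-greatest (λ i → ≤+⇒-≤ (x≤y+f i)))

    ≤inf+ : ∀ {x y} → (∀ i → x ≤ f i + y) → x ≤ inf + y
    ≤inf+ x≤f+y = ≤-trans (≤+inf (λ i → ≤-trans (x≤f+y i) (≤-reflexive (+-comm _ _))))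
                    (≤-reflexive (+-comm _ _))

-- Order and binary maxima in [0,∞].

module Extended (em : ∀ {ℓ} → ExcludedMiddle ℓ) (R : CompleteOrderedField) where
  open CompleteOrderedField R
  open Reals em R
  open Theory em R
  open NonStrict⁺ _≤≥0_ using (≤⁺-trans; ≤⁺-total; ≤⁺-reflexive-≡; ≤⁺-antisym; [≤]-injective) public

  ≤∞-refl : ∀ {u} → u ≤∞ u
  ≤∞-refl = ≤⁺-reflexive-≡ (λ { ≡.refl → ≤-refl }) ≡.refl

  ≤∞-trans : ∀ {u v w} → u ≤∞ v → v ≤∞ w → u ≤∞ w
  ≤∞-trans = ≤⁺-trans ≤-trans

  ≤∞-antisym : ∀ {u v} → u ≤∞ v → v ≤∞ u → u ≈∞ v
  ≤∞-antisym = ≤⁺-antisym antisym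

  ≰∞⇒≥∞ : ∀ {u v} → ¬ u ≤∞ v → v ≤∞ u
  ≰∞⇒≥∞ {u} {v} u≰v with ≤⁺-total (λ x y → total (proj₁ x) (proj₁ y)) u v
  ... | inj₁ u≤v = contradiction u≤v u≰v
  ... | inj₂ v≤u = v≤u

  ⊔∞-least : ∀ {u v w} → u ≤∞ w → v ≤∞ w → u ⊔∞ v ≤∞ w
  ⊔∞-least {[ _ ]} {[ _ ]} [ x≤z ]  [ y≤z ] = [ ⊔-lub x≤z y≤z ]
  ⊔∞-least {[ _ ]} {[ _ ]} (_ ≤⊤⁺) _       = _ ≤⊤⁺
  ⊔∞-least {[ _ ]} {⊤⁺}    u≤w     v≤w     = v≤w
  ⊔∞-least {⊤⁺}            u≤w     v≤w     = u≤w

  u≤u⊔∞v : ∀ u v → u ≤∞ u ⊔∞ v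
  u≤u⊔∞v [ x ] [ y ] = [ x≤x⊔y _ _ ]
  u≤u⊔∞v [ x ] ⊤⁺    = _ ≤⊤⁺
  u≤u⊔∞v ⊤⁺    v     = _ ≤⊤⁺

  v≤u⊔∞v : ∀ u v → v ≤∞ u ⊔∞ v
  v≤u⊔∞v [ x ] [ y ] = [ x≤y⊔x _ _ ]
  v≤u⊔∞v [ x ] ⊤⁺    = _ ≤⊤⁺
  v≤u⊔∞v ⊤⁺    v     = _ ≤⊤⁺

  -- For finite `u` this is the real statement; an infinite `u` is already refuted by the finite
  -- bound `v + 1`.
  ≤∞-fromAbove : ∀ {u v} → (∀ w → proj₁ v < proj₁ w → u ≤∞ [ w ]) → u ≤∞ [ v ]
  ≤∞-fromAbove {[ x ]} {v} u≤ = [ ≤-fromAbove (λ z v<z →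
    [≤]-injective (u≤ (z , ≤-trans (proj₂ v) (proj₁ v<z)) v<z)) ]
  ≤∞-fromAbove {⊤⁺}  {v} u≤
    with () ← u≤ (proj₁ v + 1# , +-nonNeg (proj₂ v) 0≤1) (x<x+1 (proj₁ v))

  ≤∞-fromUpperBounds : ∀ {u v} → (∀ w → v ≤∞ [ w ] → u ≤∞ [ w ]) → u ≤∞ v
  ≤∞-fromUpperBounds {v = [ w ]} u≤ = u≤ w ≤∞-refl
  ≤∞-fromUpperBounds {v = ⊤⁺}    u≤ = _ ≤⊤⁺

-- Polygon inequalities and nearby points of a set.

module Metric (em : ∀ {ℓ} → ExcludedMiddle ℓ) (R : CompleteOrderedField) where
  open CompleteOrderedField R hiding (zero)
  open Reals em R
  open Extended em R
  open Theory em R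
  open SemiringSolver commutativeSemiring using (solve; _:+_; _:=_)

  module MetricSpaceProperties (A : MetricSpace) where
    open MetricSpace A
    open IsGeneralMetric isMetric public
      using (triangle; cong; ≈⇒0; 0⇒≈; ≈-isEquivalence; module EqC) renaming (sym to d-sym)

    triangle′ : ∀ x y z → d x z ≤ d y x + d y z
    triangle′ x y z = ≤-trans (triangle x y z) (≤-reflexive (+-congʳ (d-sym x y)))

    -- The last leg is written `d w z` because `via` below measures distances from a point to an
    -- anchor.
    d-path₃ : ∀ x y z w → d x w ≤ d x y + d y z + d w z
    d-path₃ x y z w = begin
      d x w                 ≤⟨ triangle x z w ⟩
      d x z + d z w         ≤⟨ +-mono-≤ (triangle x y z) (≤-reflexive (d-sym z w)) ⟩
      d x y + d y z + d w z ∎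

    d-quadrilateral : ∀ {x y x′ y′ t} → d x y ≤ t → d x′ y′ ≤ t → d x x′ ≤ d y y′ + (t + t)
    d-quadrilateral {x} {y} {x′} {y′} {t} xy≤t x′y′≤t = begin
      d x x′                   ≤⟨ d-path₃ x y y′ x′ ⟩
      d x y + d y y′ + d x′ y′ ≤⟨ +-mono-≤ (+-monoˡ-≤ _ xy≤t) x′y′≤t ⟩
      t + d y y′ + t           ≈⟨ solve 2 (λ t e → t :+ e :+ t := e :+ (t :+ t)) ≈-refl t (d y y′) ⟩
      d y y′ + (t + t)         ∎

  -- If no point of `S` were within `t` of `x`, then `t` would be a lower bound of the distances,
  -- hence at most `h`. The strict inequality is there because the infimum need not be attained.
  distToSet-≤ : ∀ C {x S h t} → distToSet C x S ≤∞ [ h ] → proj₁ h < t →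
                ∃ λ ((y , _) : ∃ S) → MetricSpace.d C x y ≤ t
  distToSet-≤ C {h = h} {t} dist≤h h<t = em⇒dne em λ ∄y →
    let t≤dist = ⨅-greatest _ [ t , ≤-trans (proj₂ h) (proj₁ h<t) ] λ y →
                   ≰∞⇒≥∞ λ { [ d≤t ] → ∄y (y , d≤t) }
    in <⇒≱ h<t ([≤]-injective (≤∞-trans t≤dist dist≤h))

  -- Gluing two spaces along matched families of points.

  module _ (A B : MetricSpace) where
    private
      module A where
        open MetricSpace A public
        open MetricSpaceProperties A public
      module B where
        open MetricSpace B public
        open MetricSpaceProperties B public

    -- A ⊎ B with the largest metric that puts each pair (p i , q i) at distance t.
    module Glue {I : Set} (i₀ : I) (p : I → A.Carrier) (q : I → B.Carrier) (t : ℝ) (0<t : 0# < t)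
                (distortion : ∀ i j → ∣ A.d (p i) (p j) - B.d (q i) (q j) ∣ ≤ t + t) where

      -- The length of the path from `x` to `p i`, over a bridge of length `t` to `q i`, and on to
      -- `y`.
      via : A.Carrier → B.Carrier → I → ℝ
      via x y i = t + (A.d x (p i) + B.d y (q i))

      t≤via : ∀ x y i → t ≤ via x y i
      t≤via x y i = x≤x+y t (+-nonNeg A.nonNegative B.nonNegative)

      module Cross x y = Inf (via x y) (λ i → ≤-trans (proj₁ 0<t) (t≤via x y i)) i₀

      cross : A.Carrier → B.Carrier → ℝ
      cross = Cross.inf

      t≤cross : ∀ x y → t ≤ cross x y
      t≤cross x y = Cross.inf-greatest x y (t≤via x y)

      cross≉0 : ∀ x y → ¬ cross x y ≈ 0#
      cross≉0 x y cross≈0 = <⇒≱ 0<t (≤-trans (t≤cross x y) (≤-reflexive cross≈0))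

      cross-triangleˡ : ∀ x x′ y → cross x y ≤ A.d x x′ + cross x′ y
      cross-triangleˡ x x′ y = Cross.≤+inf x′ y λ i → begin
        cross x y
          ≤⟨ Cross.inf-lower x y i ⟩
        t + (A.d x (p i) + B.d y (q i))
          ≤⟨ +-monoʳ-≤ t (+-monoˡ-≤ _ (A.triangle x x′ (p i))) ⟩
        t + ((A.d x x′ + A.d x′ (p i)) + B.d y (q i))
          ≈⟨ solve 4 (λ t a b c → t :+ ((a :+ b) :+ c) := a :+ (t :+ (b :+ c))) ≈-refl t (A.d x x′) _ _ ⟩
        A.d x x′ + via x′ y i ∎

      cross-triangleʳ : ∀ x y y′ → cross x y ≤ B.d y y′ + cross x y′
      cross-triangleʳ x y y′ = Cross.≤+inf x y′ λ i → begin
        cross x y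
          ≤⟨ Cross.inf-lower x y i ⟩
        t + (A.d x (p i) + B.d y (q i))
          ≤⟨ +-monoʳ-≤ t (+-monoʳ-≤ _ (B.triangle y y′ (q i))) ⟩
        t + (A.d x (p i) + (B.d y y′ + B.d y′ (q i)))
          ≈⟨ solve 4 (λ t a b c → t :+ (a :+ (b :+ c)) := b :+ (t :+ (a :+ c))) ≈-refl t _ (B.d y y′) _ ⟩
        B.d y y′ + via x y′ i ∎

      -- A detour through `B` crosses two bridges, `i` and `j`. Their total length `t + t` pays for
      -- replacing the distance of `p i` and `p j` by that of `q i` and `q j`, which is then split
      -- at `y`.
      A-triangle : ∀ x x′ y → A.d x x′ ≤ cross x y + cross x′ y
      A-triangle x x′ y = Cross.≤inf+ x y λ i → Cross.≤+inf x′ y λ j → begin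
        A.d x x′
          ≤⟨ A.d-path₃ x (p i) (p j) x′ ⟩
        A.d x (p i) + A.d (p i) (p j) + A.d x′ (p j)
          ≤⟨ +-monoˡ-≤ _ (+-monoʳ-≤ _ (∣-∣≤⇒≤+ (distortion i j))) ⟩
        A.d x (p i) + (B.d (q i) (q j) + (t + t)) + A.d x′ (p j)
          ≤⟨ +-monoˡ-≤ _ (+-monoʳ-≤ _ (+-monoˡ-≤ _ (B.triangle′ (q i) y (q j)))) ⟩
        A.d x (p i) + (B.d y (q i) + B.d y (q j) + (t + t)) + A.d x′ (p j)
          ≈⟨ solve 5 (λ a b b′ t a′ → a :+ (b :+ b′ :+ (t :+ t)) :+ a′ := (t :+ (a :+ b)) :+ (t :+ (a′ :+ b′)))
               ≈-refl _ _ _ t _ ⟩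
        via x y i + via x′ y j ∎

      B-triangle : ∀ x y y′ → B.d y y′ ≤ cross x y + cross x y′
      B-triangle x y y′ = Cross.≤inf+ x y λ i → Cross.≤+inf x y′ λ j → begin
        B.d y y′
          ≤⟨ B.d-path₃ y (q i) (q j) y′ ⟩
        B.d y (q i) + B.d (q i) (q j) + B.d y′ (q j)
          ≤⟨ +-monoˡ-≤ _ (+-monoʳ-≤ _ (∣-∣≤⇒≥+ (distortion i j))) ⟩
        B.d y (q i) + (A.d (p i) (p j) + (t + t)) + B.d y′ (q j)
          ≤⟨ +-monoˡ-≤ _ (+-monoʳ-≤ _ (+-monoˡ-≤ _ (A.triangle′ (p i) x (p j)))) ⟩
        B.d y (q i) + (A.d x (p i) + A.d x (p j) + (t + t)) + B.d y′ (q j)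
          ≈⟨ solve 5 (λ b a a′ t b′ → b :+ (a :+ a′ :+ (t :+ t)) :+ b′ := (t :+ (a :+ b)) :+ (t :+ (a′ :+ b′)))
               ≈-refl _ _ _ t _ ⟩
        via x y i + via x y′ j ∎

      cross-≤ : ∀ {x x′ y y′} → x A.≈ₛ x′ → y B.≈ₛ y′ → cross x y ≤ cross x′ y′
      cross-≤ {x} {x′} {y} {y′} x≈x′ y≈y′ = begin
        cross x y                ≤⟨ cross-triangleˡ x x′ y ⟩
        A.d x x′ + cross x′ y    ≈⟨ +-congʳ (A.≈⇒0 x≈x′) ⟩
        0# + cross x′ y          ≈⟨ +-identityˡ _ ⟩
        cross x′ y               ≤⟨ cross-triangleʳ x′ y y′ ⟩
        B.d y y′ + cross x′ y′   ≈⟨ +-congʳ (B.≈⇒0 y≈y′) ⟩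
        0# + cross x′ y′         ≈⟨ +-identityˡ _ ⟩
        cross x′ y′              ∎

      cross-cong : ∀ {x x′ y y′} → x A.≈ₛ x′ → y B.≈ₛ y′ → cross x y ≈ cross x′ y′
      cross-cong x≈x′ y≈y′ = antisym (cross-≤ x≈x′ y≈y′) (cross-≤ (A.EqC.sym x≈x′) (B.EqC.sym y≈y′))

      _≈ᵍ_ : Rel (A.Carrier ⊎ B.Carrier) 0ℓ
      _≈ᵍ_ = Sum.Pointwise A._≈ₛ_ B._≈ₛ_

      dᵍ : A.Carrier ⊎ B.Carrier → A.Carrier ⊎ B.Carrier → ℝ
      dᵍ (inj₁ x) (inj₁ x′) = A.d x x′
      dᵍ (inj₁ x) (inj₂ y)  = cross x y
      dᵍ (inj₂ y) (inj₁ x)  = cross x y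
      dᵍ (inj₂ y) (inj₂ y′) = B.d y y′

      dᵍ-cong : ∀ {u u′ v v′} → u ≈ᵍ u′ → v ≈ᵍ v′ → dᵍ u v ≈ dᵍ u′ v′
      dᵍ-cong (inj₁ x≈) (inj₁ x′≈) = A.cong x≈ x′≈
      dᵍ-cong (inj₁ x≈) (inj₂ y≈)  = cross-cong x≈ y≈
      dᵍ-cong (inj₂ y≈) (inj₁ x≈)  = cross-cong x≈ y≈
      dᵍ-cong (inj₂ y≈) (inj₂ y′≈) = B.cong y≈ y′≈

      dᵍ-nonNeg : ∀ {u v} → 0# ≤ dᵍ u v
      dᵍ-nonNeg {inj₁ _} {inj₁ _} = A.nonNegative
      dᵍ-nonNeg {inj₁ x} {inj₂ y} = ≤-trans (proj₁ 0<t) (t≤cross x y)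
      dᵍ-nonNeg {inj₂ y} {inj₁ x} = ≤-trans (proj₁ 0<t) (t≤cross x y)
      dᵍ-nonNeg {inj₂ _} {inj₂ _} = B.nonNegative

      dᵍ-≈⇒0 : ∀ {u v} → u ≈ᵍ v → dᵍ u v ≈ 0#
      dᵍ-≈⇒0 (inj₁ x≈) = A.≈⇒0 x≈
      dᵍ-≈⇒0 (inj₂ y≈) = B.≈⇒0 y≈

      dᵍ-0⇒≈ : ∀ {u v} → dᵍ u v ≈ 0# → u ≈ᵍ v
      dᵍ-0⇒≈ {inj₁ _} {inj₁ _} d≈0 = inj₁ (A.0⇒≈ d≈0)
      dᵍ-0⇒≈ {inj₁ x} {inj₂ y} d≈0 = contradiction d≈0 (cross≉0 x y)
      dᵍ-0⇒≈ {inj₂ y} {inj₁ x} d≈0 = contradiction d≈0 (cross≉0 x y)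
      dᵍ-0⇒≈ {inj₂ _} {inj₂ _} d≈0 = inj₂ (B.0⇒≈ d≈0)

      dᵍ-sym : ∀ u v → dᵍ u v ≈ dᵍ v u
      dᵍ-sym (inj₁ x) (inj₁ x′) = A.d-sym x x′
      dᵍ-sym (inj₁ _) (inj₂ _)  = ≈-refl
      dᵍ-sym (inj₂ _) (inj₁ _)  = ≈-refl
      dᵍ-sym (inj₂ y) (inj₂ y′) = B.d-sym y y′

      +-comm-≤ : ∀ {a b c c′} → c ≈ c′ → a ≤ c + b → a ≤ b + c′
      +-comm-≤ c≈c′ a≤c+b = ≤-trans a≤c+b (≤-reflexive (≈-trans (+-comm _ _) (+-congˡ c≈c′)))

      dᵍ-triangle : ∀ u v w → dᵍ u w ≤ dᵍ u v + dᵍ v w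
      dᵍ-triangle (inj₁ x) (inj₁ x′) (inj₁ x″) = A.triangle x x′ x″
      dᵍ-triangle (inj₁ x) (inj₁ x′) (inj₂ y)  = cross-triangleˡ x x′ y
      dᵍ-triangle (inj₁ x) (inj₂ y)  (inj₁ x′) = A-triangle x x′ y
      dᵍ-triangle (inj₁ x) (inj₂ y)  (inj₂ y′) = +-comm-≤ (B.d-sym y′ y) (cross-triangleʳ x y′ y)
      dᵍ-triangle (inj₂ y) (inj₁ x)  (inj₁ x′) = +-comm-≤ (A.d-sym x′ x) (cross-triangleˡ x′ x y)
      dᵍ-triangle (inj₂ y) (inj₁ x)  (inj₂ y′) = B-triangle x y y′
      dᵍ-triangle (inj₂ y) (inj₂ y′) (inj₁ x)  = cross-triangleʳ x y y′
      dᵍ-triangle (inj₂ y) (inj₂ y′) (inj₂ y″) = B.triangle y y′ y″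

      glued : MetricSpace
      glued = record
        { Carrier  = A.Carrier ⊎ B.Carrier
        ; _≈ₛ_     = _≈ᵍ_
        ; d        = dᵍ
        ; isMetric = record
          { isSemiMetric = record
            { isQuasiSemiMetric = record
              { isPreMetric = record
                { isProtoMetric = record
                  { isPartialOrder  = isPartialOrder
                  ; ≈-isEquivalence = Sum.⊎-isEquivalence A.≈-isEquivalence B.≈-isEquivalence
                  ; cong            = dᵍ-cong
                  ; nonNegative     = λ {u} {v} → dᵍ-nonNeg {u} {v}
                  }
                ; ≈⇒0 = dᵍ-≈⇒0
                }
              ; 0⇒≈ = dᵍ-0⇒≈
              }
            ; sym = dᵍ-sym
            }
          ; triangle = dᵍ-triangle
          }
        }

      ι₁ : IsometricEmbedding A glued
      ι₁ = record { to = inj₁ ; isometry = λ _ _ → ≈-refl }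

      ι₂ : IsometricEmbedding B glued
      ι₂ = record { to = inj₂ ; isometry = λ _ _ → ≈-refl }

      -- By density each point is arbitrarily close to an anchor, and the partner of that anchor in
      -- the other space is only `t` further away.
      dGH≤ : (∀ x ε → 0# < ε → ∃ λ i → A.d x (p i) < ε) → (∀ y ε → 0# < ε → ∃ λ i → B.d y (q i) < ε) →
             dGH A B ≤∞ [ t , proj₁ 0<t ]
      dGH≤ p-dense q-dense = ≤∞-trans (⨅-lower _ (glued , ι₁ , ι₂)) (⊔∞-least
        (⨆-least _ _ λ where
          -- For a bound `w` above `t`, an anchor `p i` within `w - t` of `x` is chosen, and `q i`
          -- is the nearby point of `B`.
          (inj₁ x , _) → ≤∞-fromAbove λ w t<w →
            let i , dx<ε = p-dense x _ (<⇒0<- t<w)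
            in ≤∞-trans (⨅-lower _ (inj₂ (q i) , q i , inj₂ B.EqC.refl)) [ begin
                 cross x (q i)                        ≤⟨ Cross.inf-lower x (q i) i ⟩
                 t + (A.d x (p i) + B.d (q i) (q i))  ≈⟨ +-congˡ (≈-trans (+-congˡ (B.≈⇒0 B.EqC.refl)) (+-identityʳ _)) ⟩
                 t + A.d x (p i)                      ≤⟨ ≤-⇒+≤ (proj₁ dx<ε) ⟩
                 proj₁ w                              ∎ ]
          (inj₂ y , _ , ()))
        (⨆-least _ _ λ where
          (inj₁ x , _ , ())
          (inj₂ y , _) → ≤∞-fromAbove λ w t<w →
            let i , dy<ε = q-dense y _ (<⇒0<- t<w)
            in ≤∞-trans (⨅-lower _ (inj₁ (p i) , p i , inj₁ A.EqC.refl)) [ begin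
                 cross (p i) y                        ≤⟨ Cross.inf-lower (p i) y i ⟩
                 t + (A.d (p i) (p i) + B.d y (q i))  ≈⟨ +-congˡ (≈-trans (+-congʳ (A.≈⇒0 A.EqC.refl)) (+-identityˡ _)) ⟩
                 t + B.d y (q i)                      ≤⟨ ≤-⇒+≤ (proj₁ dy<ε) ⟩
                 proj₁ w                              ∎ ]))

    module _ (diamA : DiameterAtMost1 A) (diamB : DiameterAtMost1 B) where
      open BackAndForth A B diamA diamB

      -- The inequality r∞ ≤ d_GH, by means of correspondences of distortion at most 2t.

      module _ (t : ℝ≥0) (_∼_ : REL A.Carrier B.Carrier 0ℓ)
               (distortion : ∀ {x y x′ y′} → x ∼ y → x′ ∼ y′ →
                             ∣ A.d x x′ - B.d y y′ ∣ ≤ proj₁ t + proj₁ t)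
               (forth : ∀ x → ∃ λ y → x ∼ y) (back : ∀ y → ∃ λ x → x ∼ y) where

        -- Atoms differ by at most `t + t`, which is exactly their modulus at the constant tuple
        -- `t`. So the values of a formula differ by at most its own modulus there, which `ΩL`
        -- bounds by `t`.
        r₀-≤ : ∀ {n} {a : Vec A.Carrier n} {b} → Pointwise _∼_ a b → r₀ a b ≤∞ [ t ]
        r₀-≤ {a = a} {b} a∼b = ⨆-least _ _ λ (φ , φ≤ΩL) →
          ≤∞-trans (⨆-upper _ ((_ , _) , λ l → distortion (Pointwise.lookup a∼b _) (Pointwise.lookup a∼b _)))
            (≤∞-trans (φ≤ΩL (λ _ → t)) (⨆-least _ _ (λ _ → ≤∞-refl)))

        mutual
          -- Induction on `α`. At a successor, `forth` and `back` supply the answers, and appending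
          -- related points keeps the tuples related.
          r-≤ : ∀ α {n} {a : Vec A.Carrier n} {b} → Pointwise _∼_ a b → r α a b ≤∞ [ t ]
          r-≤ zeroᵒ             a∼b = r₀-≤ a∼b
          r-≤ (sucᵒ α)          a∼b = ⨆-least _ _ λ (c , d) →
            let d′ , c∼d′ = forth c
                c′ , c′∼d = back d
            in ≤∞-trans (⨅-lower _ (c′ , d′))
                 (⊔∞-least (r-≤ α (∷ʳ⁺ a∼b c∼d′)) (r-≤ α (∷ʳ⁺ a∼b c′∼d)))
          r-≤ α@(limᵒ I f _ _) a∼b = ⨆-least _ _ λ (_ , β<α) → r<-≤ α β<α a∼b

          r<-≤ : ∀ α {β} (β<α : β <ᵒ α) {n} {a : Vec A.Carrier n} {b} →
                 Pointwise _∼_ a b → r< α β<α a b ≤∞ [ t ]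
          r<-≤ (sucᵒ α)       <-suc         a∼b = r-≤ α a∼b
          r<-≤ (sucᵒ α)       (<-step β<α)  a∼b = r<-≤ α β<α a∼b
          r<-≤ (limᵒ I f _ _) (<-lim i β<α) a∼b = r<-≤ (f i) β<α a∼b

      r∞≤dGH : r∞ [] [] ≤∞ dGH A B
      r∞≤dGH = ⨅-greatest _ _ λ (C , f₁ , f₂) → r∞≤dH C f₁ f₂
        where
        module _ (C : MetricSpace) (f₁ : IsometricEmbedding A C) (f₂ : IsometricEmbedding B C) where
          module C where
            open MetricSpace C public
            open MetricSpaceProperties C public
          module f₁ = IsometricEmbedding f₁
          module f₂ = IsometricEmbedding f₂

          close : ℝ → REL A.Carrier B.Carrier 0ℓ
          close t x y = C.d (f₁.to x) (f₂.to y) ≤ t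

          distortion : ∀ t {x y x′ y′} → close t x y → close t x′ y′ →
                       ∣ A.d x x′ - B.d y y′ ∣ ≤ t + t
          distortion t {x} {y} {x′} {y′} p q = ∣-∣≤
            (begin
              A.d x x′                                   ≈⟨ f₁.isometry x x′ ⟨
              C.d (f₁.to x) (f₁.to x′)                   ≤⟨ C.d-quadrilateral p q ⟩
              C.d (f₂.to y) (f₂.to y′) + (t + t)         ≈⟨ +-congʳ (f₂.isometry y y′) ⟩
              B.d y y′ + (t + t)                         ∎)
            (begin
              B.d y y′                                   ≈⟨ f₂.isometry y y′ ⟨
              C.d (f₂.to y) (f₂.to y′)                   ≤⟨ C.d-quadrilateral (swap p) (swap q) ⟩
              C.d (f₁.to x) (f₁.to x′) + (t + t)         ≈⟨ +-congʳ (f₁.isometry x x′) ⟩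
              A.d x x′ + (t + t)                         ∎)
            where
            swap : ∀ {z w} → C.d z w ≤ t → C.d w z ≤ t
            swap = ≤-trans (≤-reflexive (C.d-sym _ _))

          module _ {h : ℝ≥0} (dH≤h : dH C f₁.image f₂.image ≤∞ [ h ])
                   {t : ℝ} (h<t : proj₁ h < t) where

            forth : ∀ x → ∃ λ y → close t x y
            forth x =
              let (z , y , fy≈z) , p = distToSet-≤ C (≤∞-trans
                    (≤∞-trans (⨆-upper _ (f₁.to x , x , C.EqC.refl)) (u≤u⊔∞v _ _)) dH≤h) h<t
              in y , ≤-trans (≤-reflexive (C.cong C.EqC.refl fy≈z)) p

            back : ∀ y → ∃ λ x → close t x y
            back y =
              let (z , x , fx≈z) , p = distToSet-≤ C (≤∞-trans
                    (≤∞-trans (⨆-upper _ (f₂.to y , y , C.EqC.refl)) (v≤u⊔∞v _ _)) dH≤h) h<t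
              in x , ≤-trans (≤-reflexive (≈-trans (C.d-sym _ _) (C.cong C.EqC.refl fx≈z))) p

          r∞≤dH : r∞ [] [] ≤∞ dH C f₁.image f₂.image
          -- A finite bound `h` and then a larger `t` are taken so that points within `t` exist in
          -- both directions; the empty tuples are vacuously related.
          r∞≤dH = ≤∞-fromUpperBounds λ h dH≤h → ≤∞-fromAbove λ t h<t → ⨆-least _ _ λ α →
            r-≤ t (close (proj₁ t)) (distortion (proj₁ t)) (forth dH≤h h<t) (back dH≤h h<t) α []

      -- What a bound on r∞ provides: small distortion and back-and-forth moves.

      -- The modulus of an atom is a sum of two entries of `δ`, which may be twice their maximum;
      -- the factor `½` brings it below `ΩL`.
      ½d : ∀ {n} → Fin n → Fin n → ΩLFormula n
      ½d i j = record
        { atoms      = λ (_ : Fin 1) → i , j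
        ; connective = λ x → ½ * proj₁ (x zero)
        ; continuous = λ x ε 0<ε → ε , 0<ε , λ y ∣x-y∣<ε → begin-strict
            ∣ ½ * proj₁ (x zero) - ½ * proj₁ (y zero) ∣ ≤⟨ ∣½*-½*∣≤ (x≤x+y _ (0≤∣x∣ _)) ⟩
            ∣ proj₁ (x zero) - proj₁ (y zero) ∣         <⟨ ∣x-y∣<ε zero ⟩
            ε                                           ∎
        } , λ δ → ≤∞-fromUpperBounds λ w ΩLδ≤w → ⨆-least _ _ λ (_ , ∣x-y∣≤) →
          let δ≤w = λ k → [≤]-injective (≤∞-trans (⨆-upper (λ k → [ δ k ]) k) ΩLδ≤w)
          in [ ∣½*-½*∣≤ (≤-trans (∣x-y∣≤ zero) (+-mono-≤ (δ≤w i) (δ≤w j))) ]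

      r₀-distortion : ∀ {n} (a : Vec A.Carrier n) b {u} → r₀ a b ≤∞ [ u ] → ∀ i j →
        ∣ A.d (lookup a i) (lookup a j) - B.d (lookup b i) (lookup b j) ∣ ≤ proj₁ u + proj₁ u
      r₀-distortion a b r₀≤u i j = ∣½*-½*∣≤⁻¹ ([≤]-injective (≤∞-trans (⨆-upper _ (½d i j)) r₀≤u))

      -- The supremum at a limit is formed with `r<`, which `r<-correct` identifies with `r β`.
      r-lim-upper : ∀ {β I f i₀ incr} → β <ᵒ limᵒ I f i₀ incr →
                    ∀ {n} (a : Vec A.Carrier n) b → r β a b ≤∞ r (limᵒ I f i₀ incr) a b
      r-lim-upper {β} β<α a b =
        ≡.subst (_≤∞ _) (r<-correct _ β<α a b) (⨆-upper _ (β , β<α))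

      -- The failure of every pair of answers (c′ , d′) at some ordinal α is witnessed
      -- at the supremum of these α, hence one step later already for (a , b).
      r∞-back-and-forth : ∀ {n} {a : Vec A.Carrier n} {b} {u t : ℝ≥0} →
        r∞ a b ≤∞ [ u ] → proj₁ u < proj₁ t → ∀ c d →
        ∃ λ ((c′ , d′) : A.Carrier × B.Carrier) →
          r∞ (a ∷ʳ c) (b ∷ʳ d′) ≤∞ [ t ] × r∞ (a ∷ʳ c′) (b ∷ʳ d) ≤∞ [ t ]
      r∞-back-and-forth {a = a} {b} {u} {t} r∞≤u u<t c d = em⇒dne em λ ∄answer →
        let
          failure : ∀ answer → ∃ λ α → ¬ outcome α answer ≤∞ [ t ]
          failure answer = em⇒dne em λ ∄α →
            let outcome≤t = λ α → em⇒dne em λ outcome≰t → ∄α (α , outcome≰t)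
            in ∄answer (answer , ⨆-least _ _ (λ α → ≤∞-trans (u≤u⊔∞v _ _) (outcome≤t α))
                               , ⨆-least _ _ (λ α → ≤∞-trans (v≤u⊔∞v _ _) (outcome≤t α)))
          -- Here `(c , d)` merely witnesses that the set of answers is inhabited.
          γ = supᵒ (c , d) (λ answer → proj₁ (failure answer))
          t≤outcome : ∀ answer → [ t ] ≤∞ outcome γ answer
          t≤outcome answer = ≰∞⇒≥∞ λ outcome≤t → proj₂ (failure answer) (⊔∞-least
            (≤∞-trans (≤∞-trans (r-lim-upper (<ᵒ-supᵒ _ answer) _ _) (u≤u⊔∞v _ _)) outcome≤t)
            (≤∞-trans (≤∞-trans (r-lim-upper (<ᵒ-supᵒ _ answer) _ _) (v≤u⊔∞v _ _)) outcome≤t))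
        in <⇒≱ u<t ([≤]-injective (≤∞-trans (⨅-greatest _ _ t≤outcome)
             (≤∞-trans (⨆-upper _ (c , d)) (≤∞-trans (⨆-upper _ (sucᵒ γ)) r∞≤u))))
        where
        outcome : Ord → A.Carrier × B.Carrier → [0,∞]
        outcome α (c′ , d′) = r α (a ∷ʳ c) (b ∷ʳ d′) ⊔∞ r α (a ∷ʳ c′) (b ∷ʳ d)

      -- The back-and-forth game with bound below t.

      module Game (t : ℝ≥0) where

        -- The bound `u` stays strictly below `t`, which leaves room for every move to raise it.
        record Position : Set where
          constructor position
          field
            {size} : ℕ
            left   : Vec A.Carrier size
            right  : Vec B.Carrier size
            bound  : ∃ λ (u : ℝ≥0) → proj₁ u < proj₁ t × r∞ left right ≤∞ [ u ]

        open Position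

        infix 4 _∋_ _⊑_
        _∋_ : Position → A.Carrier × B.Carrier → Set
        P ∋ (x , y) = ∃ λ i → lookup (left P) i ≡ x × lookup (right P) i ≡ y

        _⊑_ : Position → Position → Set
        P ⊑ Q = ∀ {xy} → P ∋ xy → Q ∋ xy

        ∋-distortion : ∀ P {x y x′ y′} → P ∋ (x , y) → P ∋ (x′ , y′) →
                       ∣ A.d x x′ - B.d y y′ ∣ ≤ proj₁ t + proj₁ t
        ∋-distortion P (i , ≡.refl , ≡.refl) (j , ≡.refl , ≡.refl) =
          let u , u<t , r∞≤u = bound P
          in ≤-trans (r₀-distortion (left P) (right P) (≤∞-trans (⨆-upper _ zeroᵒ) r∞≤u) i j)
               (+-mono-≤ (proj₁ u<t) (proj₁ u<t))

        extend : ∀ P x y → (∃ λ (u : ℝ≥0) → proj₁ u < proj₁ t × r∞ (left P ∷ʳ x) (right P ∷ʳ y) ≤∞ [ u ]) →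
                 ∃ λ Q → P ⊑ Q × Q ∋ (x , y)
        extend P x y bd = position (left P ∷ʳ x) (right P ∷ʳ y) bd
          , (λ { (i , ≡.refl , ≡.refl) →
                 inject₁ i , lookup-∷ʳ-inject₁ (left P) x i , lookup-∷ʳ-inject₁ (right P) y i })
          , fromℕ _ , lookup-∷ʳ-last (left P) x , lookup-∷ʳ-last (right P) y

        respond : ∀ P x y → ∃ λ ((x′ , y′) : A.Carrier × B.Carrier) →
          (∃ λ Q → P ⊑ Q × Q ∋ (x , y′)) × (∃ λ Q → P ⊑ Q × Q ∋ (x′ , y))
        respond P x y =
          let u , u<t , r∞≤u = bound P
              -- Answers exist only for a bound above `u`; taking it below `t` makes the result a
              -- position again.
              z , u<z , z<t  = <-dense u<t
              v = z , ≤-trans (proj₂ u) (proj₁ u<z)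
              (x′ , y′) , p , q = r∞-back-and-forth {t = v} r∞≤u u<z x y
          in (x′ , y′) , extend P x y′ (v , z<t , p) , extend P x′ y (v , z<t , q)

        abstract
          -- One response yields two separate extensions, one covering `x` and one covering `y`. To
          -- cover both in one position, a second response is made from the extension that covers
          -- `x`.
          round : ∀ P x y → ∃ λ Q → P ⊑ Q × (∃ λ y′ → Q ∋ (x , y′)) × (∃ λ x′ → Q ∋ (x′ , y))
          round P x y =
            let (_  , y′) , (Q , P⊑Q , Q∋) , _ = respond P x y
                (x′ , _)  , _ , (S , Q⊑S , S∋) = respond Q x y
            in S , (λ P∋ → Q⊑S (P⊑Q P∋)) , (y′ , Q⊑S Q∋) , (x′ , S∋)

        module Play (start : Position) (x : ℕ → A.Carrier) (y : ℕ → B.Carrier) where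

          play : ℕ → Position
          play zero    = start
          play (suc n) = proj₁ (round (play n) (x n) (y n))

          play-mono : ∀ {m n} → m ℕ.≤′ n → play m ⊑ play n
          play-mono (ℕ.≤′-reflexive ≡.refl) P∋ = P∋
          play-mono (ℕ.≤′-step {n = n} m≤n) P∋ = proj₁ (proj₂ (round (play n) (x n) (y n))) (play-mono {n = n} m≤n P∋)

          -- The union of all positions of the play, which indexes the families `fst` and `snd` used
          -- for gluing.
          Pair : Set
          Pair = ∃ λ n → ∃ (play n ∋_)

          fst : Pair → A.Carrier
          fst (_ , (x , _) , _) = x

          snd : Pair → B.Carrier
          snd (_ , (_ , y) , _) = y

          x-fst : ∀ n → ∃ λ i → fst i ≡ x n
          x-fst n = let _ , _ , (y′ , ∋x) , _ = round (play n) (x n) (y n)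
                    in (suc n , (x n , y′) , ∋x) , ≡.refl

          y-snd : ∀ n → ∃ λ i → snd i ≡ y n
          y-snd n = let _ , _ , _ , (x′ , ∋y) = round (play n) (x n) (y n)
                    in (suc n , (x′ , y n) , ∋y) , ≡.refl

          -- Positions only grow, so both pairs occur together at the later of their two stages.
          Pair-distortion : ∀ i j → ∣ A.d (fst i) (fst j) - B.d (snd i) (snd j) ∣ ≤ proj₁ t + proj₁ t
          Pair-distortion (m , _ , m∋) (n , _ , n∋) = ∋-distortion (play (m ℕ.⊔ n))
            (play-mono {n = m ℕ.⊔ n} (ℕ.≤⇒≤′ (ℕ.m≤m⊔n m n)) m∋) (play-mono {n = m ℕ.⊔ n} (ℕ.≤⇒≤′ (ℕ.m≤n⊔m m n)) n∋)

      -- The inequality d_GH ≤ r∞.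

      dGH≤r∞ : Separable A → Separable B → dGH A B ≤∞ r∞ [] []
      dGH≤r∞ (x , x-dense) (y , y-dense) = ≤∞-fromUpperBounds λ u r∞≤u → ≤∞-fromAbove λ t u<t →
        let open Game t
            -- The play starts from the empty tuples and covers the two dense sequences in turn, so
            -- `fst` and `snd` inherit density.
            open Play (position [] [] (u , u<t , r∞≤u)) x y
            0<t = ≰⇒> (λ t≤0 → <⇒≱ u<t (≤-trans t≤0 (proj₂ u)))
            fst-dense = λ a ε 0<ε → let n , d<ε = x-dense a ε 0<ε
                                        i , i≡  = x-fst n
                                    in i , ≡.subst (λ z → A.d a z < ε) (≡.sym i≡) d<ε
            snd-dense = λ b ε 0<ε → let n , d<ε = y-dense b ε 0<ε
                                        i , i≡  = y-snd n
                                    in i , ≡.subst (λ z → B.d b z < ε) (≡.sym i≡) d<ε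
        in ≤∞-trans (Glue.dGH≤ (proj₁ (x-fst 0)) fst snd (proj₁ t) 0<t Pair-distortion fst-dense snd-dense)
             -- Both sides are `t`, but with different proofs of nonnegativity.
             [ ≤-refl ]

theorem8p1 : (em : ∀ {ℓ} → ExcludedMiddle ℓ) (R : CompleteOrderedField) →
    let open Theory em R in
    (A B : MetricSpace) →
    Separable A → Complete A → Separable B → Complete B →
    (diamA : DiameterAtMost1 A) (diamB : DiameterAtMost1 B) →
    BackAndForth.r∞ A B diamA diamB [] [] ≈∞ dGH A B
theorem8p1 em R A B sepA _ sepB _ diamA diamB =
  ≤∞-antisym (r∞≤dGH A B diamA diamB) (dGH≤r∞ A B diamA diamB sepA sepB)
  where
  open Extended em R using (≤∞-antisym)
  open Metric em R using (r∞≤dGH; dGH≤r∞)
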